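{- For every real constant $c>0$ and every positive integer $N_0$, there exist an integer $N\ge N_0$ and a bipartite graph $G$ on $N$ vertices such that $G$ contains no cycle of length $10$ (i.e. $G$ is $C_{10}$-free), and every subgraph of $G$ with at least $c\,|E(G)|$ edges contains a cycle of length $8$ (a copy of $C_8$).
   Context: $C_m$ denotes the cycle of length $m$. A graph is $F$-free if it contains no subgraph isomorphic to $F$. -}

module Defs where

open import Data.Bool using (Bool)
open import Data.Fin using (Fin; toℕ)
open import Data.Fin.Properties using (_<?_)
open import Data.Fin.Subset using (Subset; _∈_; ⊤)
open import Data.Fin.Subset.Properties using (∈⊤)
open import Data.Integer using (+_)
open import Data.List using (length; filter; cartesianProduct; allFin)
open import Data.Nat as ℕ using (ℕ; suc)
open import Data.Nat.Properties using (1+n≢n)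
open import Data.Product using (Σ; ∃; _×_; _,_)
open import Data.Rational as ℚ using (ℚ; 0ℚ)
open import Data.Sum using (_⊎_; inj₁; inj₂; swap)
open import Function using (_⇔_)
open import Function.Definitions using (Injective)
open import Level using (0ℓ)
open import Relation.Binary.Core using (Rel)
open import Relation.Binary.Definitions using (Decidable; Symmetric; Irreflexive)
open import Relation.Binary.PropositionalEquality using (_≡_; _≢_; refl; sym; trans; cong)
open import Relation.Nullary using (¬_; contradiction)
open import Relation.Nullary.Decidable using (True; toWitness; _×-dec_; _⊎-dec_)

-- Two-sided, located Dedekind cuts: L q means q < x, and U q means x < q.
record ℝ : Set₁ where
  field
    L U         : ℚ → Set
    L-inhabited : ∃ L
    U-inhabited : ∃ U
    L-rounded   : ∀ q → L q ⇔ (∃ λ r → q ℚ.< r × L r)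
    U-rounded   : ∀ q → U q ⇔ (∃ λ r → r ℚ.< q × U r)
    disjoint    : ∀ q → ¬ (L q × U q)
    located     : ∀ q r → q ℚ.< r → L q ⊎ U r

Positive : ℝ → Set
Positive x = ℝ.L x 0ℚ

ℕ→ℚ : ℕ → ℚ
ℕ→ℚ n = + n ℚ./ 1

-- x · n ≤ m.  As n ≥ 0, x · n is the least upper bound of the numbers q · n
-- over the rationals q < x (also when n = 0, as L x is inhabited).
_·_≤ᴿ_ : ℝ → ℕ → ℕ → Set
x · n ≤ᴿ m = ∀ q → ℝ.L x q → q ℚ.* ℕ→ℚ n ℚ.≤ ℕ→ℚ m

record Graph (n : ℕ) : Set₁ where
  infix 4 _~_ _~?_
  field
    _~_      : Rel (Fin n) 0ℓ
    _~?_     : Decidable _~_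
    ~-sym    : Symmetric _~_
    ~-irrefl : Irreflexive _≡_ _~_

-- Each edge {i, j} is counted once, as the ordered pair with i < j.
∣E_∣ : ∀ {n} → Graph n → ℕ
∣E_∣ {n} G =
  length (filter (λ (i , j) → (i <? j) ×-dec (i ~? j))
                 (cartesianProduct (allFin n) (allFin n)))
  where open Graph G

Bipartite : ∀ {n} → Graph n → Set
Bipartite {n} G = Σ (Fin n → Bool) λ side → ∀ {i j} → i ~ j → side i ≢ side j
  where open Graph G

-- A subgraph need not be induced or spanning: its edge set is recorded as a
-- graph on the ambient vertices, whose edges have both ends in `vertices`
-- (the second end by symmetry).
record Subgraph {n : ℕ} (G : Graph n) : Set₁ where
  field
    vertices : Subset n
    edges    : Graph n
    edges⊆   : ∀ {i j} → Graph._~_ edges i j → Graph._~_ G i j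
    incident : ∀ {i j} → Graph._~_ edges i j → i ∈ vertices

whole : ∀ {n} (G : Graph n) → Subgraph G
whole G = record
  { vertices = ⊤
  ; edges    = G
  ; edges⊆   = λ e → e
  ; incident = λ _ → ∈⊤
  }

-- A (not necessarily induced) copy of F in H.
record Copy {k n : ℕ} (F : Graph k) {G : Graph n} (H : Subgraph G) : Set where
  open Subgraph H
  field
    embed     : Fin k → Fin n
    injective : Injective _≡_ _≡_ embed
    vertex    : ∀ i → embed i ∈ vertices
    edge      : ∀ {i j} → Graph._~_ F i j → Graph._~_ edges (embed i) (embed j)

_-Free : ∀ {k n} → Graph k → Graph n → Set
(F -Free) G = ¬ Copy F (whole G)

-- j is the cyclic successor of i.
Next : ∀ {m} → Fin m → Fin m → Set
Next {m} i j = toℕ j ≡ suc (toℕ i) ⊎ (suc (toℕ i) ≡ m × toℕ j ≡ 0)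

next? : ∀ {m} → Decidable (Next {m})
next? {m} i j =
  (toℕ j ℕ.≟ suc (toℕ i)) ⊎-dec ((suc (toℕ i) ℕ.≟ m) ×-dec (toℕ j ℕ.≟ 0))

next-irrefl : ∀ {m} → 3 ℕ.≤ m → (i : Fin m) → ¬ Next i i
next-irrefl _   i (inj₁ i≡1+i)         = 1+n≢n (sym i≡1+i)
next-irrefl 3≤m i (inj₂ (1+i≡m , i≡0)) with trans (sym 1+i≡m) (cong suc i≡0)
next-irrefl (ℕ.s≤s ()) i (inj₂ _) | refl

C : (m : ℕ) → {True (3 ℕ.≤? m)} → Graph m
C m {3≤m} = record
  { _~_      = λ i j → Next i j ⊎ Next j i
  ; _~?_     = λ i j → next? i j ⊎-dec next? j i
  ; ~-sym    = swap
  ; ~-irrefl = λ { {i} refl (inj₁ p) → next-irrefl (toWitness 3≤m) i p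
                 ; {i} refl (inj₂ p) → next-irrefl (toWitness 3≤m) i p }
  }

{-# OPTIONS --safe #-}
module Submission where

-- G is the incidence graph of the points and the axis-parallel lines of the
-- grid [n]^d. A cycle of length 2m in G is a closed walk of m axis-parallel
-- moves in which consecutive directions differ and every direction that occurs
-- occurs at least twice. For m = 5 this is impossible, so G is C₁₀-free; for
-- m = 4 it is a rectangle. A subgraph keeping a positive proportion of the
-- incidences contains the incidences of a rectangle once d and then n are large,
-- by two second-moment counts: one finds two directions that are often kept
-- together, the other a rectangle in a plane spanned by them.

open import Defs
open import Data.Bool using (Bool; true; false; if_then_else_)
open import Data.Empty using (⊥; ⊥-elim)
open import Data.Fin as Fin using (Fin; zero; suc; toℕ; combine; remQuot)
open import Data.Fin.Patterns
open import Data.Fin.Properties as Fin using (any?; all?)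
import Data.Integer as ℤ
import Data.Integer.Properties as ℤ
open import Data.List using (List; []; _∷_; _++_; length; filter; map; lookup; allFin;
  cartesianProduct; cartesianProductWith)
import Data.List.Properties as List
open import Data.List.Membership.Propositional using (_∈_)
open import Data.List.Membership.Propositional.Properties
open import Data.List.Membership.Setoid.Properties using (index-injective)
open import Data.List.Relation.Unary.All as All using ([]; _∷_)
open import Data.List.Relation.Unary.AllPairs using ([]; _∷_)
open import Data.List.Relation.Unary.Any using (here; there; index)
open import Data.List.Relation.Unary.Unique.Propositional using (Unique)
import Data.List.Relation.Unary.Unique.Propositional.Properties as Unique
open import Data.Nat
open import Data.Nat.DivMod using (_mod_)
open import Data.Nat.ListAction using (sum)
open import Data.Nat.ListAction.Properties using (sum-++)
open import Data.Nat.Properties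
open import Data.Nat.Tactic.RingSolver using (solve-∀)
open import Data.Product using (Σ; ∃; ∃₂; _×_; _,_; proj₁; proj₂; uncurry)
open import Data.Rational as ℚ using (mkℚ; *<*)
import Data.Rational.Properties as ℚ
import Data.Rational.Unnormalised as ℚᵘ
import Data.Rational.Unnormalised.Properties as ℚᵘ
open import Data.Sum using (_⊎_; inj₁; inj₂; [_,_]; swap)
open import Data.Vec as Vec using (Vec; []; _∷_; _[_]≔_)
import Data.Vec.Properties as Vec
open import Function using (_∘_; Equivalence; Injective)
open import Relation.Binary.PropositionalEquality hiding ([_])
open import Relation.Nullary using (Dec; yes; no; ¬_; does; contradiction)
open import Relation.Nullary.Decidable using (_×-dec_; _→-dec_; _⊎-dec_; ¬?; from-yes)
open import Relation.Unary using (Pred; Decidable)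

private variable
  A B D : Set
  m n d k : ℕ

-- Finite sums and counting

∑ : List A → (A → ℕ) → ℕ
∑ xs f = sum (map f xs)

𝟙 : Dec A → ℕ
𝟙 P? = if does P? then 1 else 0

𝟙≤1 : (P? : Dec A) → 𝟙 P? ≤ 1
𝟙≤1 (yes _) = ≤-refl
𝟙≤1 (no _)  = z≤n

𝟙-× : (P? : Dec A) (Q? : Dec B) → 𝟙 (P? ×-dec Q?) ≡ 𝟙 P? * 𝟙 Q?
𝟙-× (yes _) (yes _) = refl
𝟙-× (yes _) (no _)  = refl
𝟙-× (no _)  _       = refl

∑-cong : (xs : List A) {f g : A → ℕ} → (∀ x → f x ≡ g x) → ∑ xs f ≡ ∑ xs g
∑-cong xs f≗g = cong sum (List.map-cong f≗g xs)

∑-mono : (xs : List A) {f g : A → ℕ} → (∀ x → f x ≤ g x) → ∑ xs f ≤ ∑ xs g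
∑-mono []       f≤g = z≤n
∑-mono (x ∷ xs) f≤g = +-mono-≤ (f≤g x) (∑-mono xs f≤g)

∑-+ : (xs : List A) (f g : A → ℕ) → ∑ xs (λ x → f x + g x) ≡ ∑ xs f + ∑ xs g
∑-+ []       f g = refl
∑-+ (x ∷ xs) f g rewrite ∑-+ xs f g = interchange (f x) (g x) (∑ xs f) (∑ xs g)
  where
  interchange : ∀ a b c e → a + b + (c + e) ≡ a + c + (b + e)
  interchange = solve-∀

∑-*ˡ : (xs : List A) (c : ℕ) (f : A → ℕ) → ∑ xs (λ x → c * f x) ≡ c * ∑ xs f
∑-*ˡ []       c f = sym (*-zeroʳ c)
∑-*ˡ (x ∷ xs) c f rewrite ∑-*ˡ xs c f = sym (*-distribˡ-+ c (f x) (∑ xs f))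

∑-*ʳ : (xs : List A) (f : A → ℕ) (c : ℕ) → ∑ xs (λ x → f x * c) ≡ ∑ xs f * c
∑-*ʳ []       f c = refl
∑-*ʳ (x ∷ xs) f c rewrite ∑-*ʳ xs f c = sym (*-distribʳ-+ c (f x) (∑ xs f))

∑-const : (xs : List A) (c : ℕ) → ∑ xs (λ _ → c) ≡ length xs * c
∑-const []       c = refl
∑-const (_ ∷ xs) c = cong (c +_) (∑-const xs c)

∑-swap : (xs : List A) (ys : List B) (f : A → B → ℕ) →
         ∑ xs (λ x → ∑ ys (f x)) ≡ ∑ ys (λ y → ∑ xs (λ x → f x y))
∑-swap []       ys f = sym (trans (∑-const ys 0) (*-zeroʳ (length ys)))
∑-swap (x ∷ xs) ys f rewrite ∑-swap xs ys f = sym (∑-+ ys (f x) _)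

∑-cartesianProductWith : (h : A → B → D) (xs : List A) (ys : List B) (f : D → ℕ) →
  ∑ (cartesianProductWith h xs ys) f ≡ ∑ xs (λ x → ∑ ys (λ y → f (h x y)))
∑-cartesianProductWith h []       ys f = refl
∑-cartesianProductWith h (x ∷ xs) ys f = begin
  sum (map f (map (h x) ys ++ cartesianProductWith h xs ys))
    ≡⟨ cong sum (List.map-++ f (map (h x) ys) _) ⟩
  sum (map f (map (h x) ys) ++ map f (cartesianProductWith h xs ys))
    ≡⟨ sum-++ (map f (map (h x) ys)) _ ⟩
  sum (map f (map (h x) ys)) + ∑ (cartesianProductWith h xs ys) f
    ≡⟨ cong₂ _+_ (cong sum (sym (List.map-∘ ys))) (∑-cartesianProductWith h xs ys f) ⟩
  ∑ ys (λ y → f (h x y)) + ∑ xs (λ x → ∑ ys (λ y → f (h x y))) ∎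
  where open ≡-Reasoning

length-filter-∑ : {P : Pred A _} (P? : Decidable P) (xs : List A) →
                  length (filter P? xs) ≡ ∑ xs (λ x → 𝟙 (P? x))
length-filter-∑ P? []       = refl
length-filter-∑ P? (x ∷ xs) with P? x
... | yes _ = cong suc (length-filter-∑ P? xs)
... | no _  = length-filter-∑ P? xs

length-allFin : ∀ n → length (allFin n) ≡ n
length-allFin n = List.length-tabulate (λ i → i)

∑-allFin-const : ∀ n c → ∑ (allFin n) (λ _ → c) ≡ n * c
∑-allFin-const n c = trans (∑-const (allFin n) c) (cong (_* c) (length-allFin n))

length-cartesianProductWith : (h : A → B → D) (xs : List A) (ys : List B) →
  length (cartesianProductWith h xs ys) ≡ length xs * length ys
length-cartesianProductWith h []       ys = refl
length-cartesianProductWith h (x ∷ xs) ys =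
  trans (List.length-++ (map (h x) ys))
        (cong₂ _+_ (List.length-map (h x) ys) (length-cartesianProductWith h xs ys))

pigeonhole : (xs : List A) (f : A → ℕ) (c : ℕ) → length xs * c < ∑ xs f → ∃ λ x → c < f x
pigeonhole (x ∷ xs) f c lt with c <? f x
... | yes c<fx = x , c<fx
... | no  c≮fx = pigeonhole xs f c
  (+-cancelˡ-< c _ _ (<-≤-trans lt (+-monoˡ-≤ (∑ xs f) (≮⇒≥ c≮fx))))

∑𝟙-∃ : {P : Pred A _} (P? : Decidable P) (xs : List A) → 0 < ∑ xs (λ x → 𝟙 (P? x)) →
       ∃ λ x → x ∈ xs × P x
∑𝟙-∃ P? (x ∷ xs) pos with P? x
... | yes Px = x , here refl , Px
... | no _   with y , y∈ , Py ← ∑𝟙-∃ P? xs pos = y , there y∈ , Py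

∑𝟙-∃₂ : {P : Pred A _} (P? : Decidable P) {xs : List A} → Unique xs →
        1 < ∑ xs (λ x → 𝟙 (P? x)) → ∃₂ λ x y → x ≢ y × P x × P y
∑𝟙-∃₂ P? {x ∷ xs} (x∉ ∷ u) lt with P? x
... | no _   = ∑𝟙-∃₂ P? u lt
... | yes Px with y , y∈ , Py ← ∑𝟙-∃ P? xs (s≤s⁻¹ lt) = x , y , All.lookup x∉ y∈ , Px , Py

∑-𝟙≟ : (a : Fin n) → ∑ (allFin n) (λ b → 𝟙 (a Fin.≟ b)) ≤ 1
∑-𝟙≟ {n} a = ≮⇒≥ λ lt →
  let _ , _ , x≢y , a≡x , a≡y = ∑𝟙-∃₂ (a Fin.≟_) (Unique.allFin⁺ n) lt
  in x≢y (trans (sym a≡x) a≡y)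

Unique⇒lookup-injective : {xs : List A} → Unique xs → Injective _≡_ _≡_ (lookup xs)
Unique⇒lookup-injective (_  ∷ _) {zero}  {zero}  _  = refl
Unique⇒lookup-injective (x∉ ∷ _) {zero}  {suc j} eq = ⊥-elim (All.lookup x∉ (∈-lookup j) eq)
Unique⇒lookup-injective (x∉ ∷ _) {suc i} {zero}  eq = ⊥-elim (All.lookup x∉ (∈-lookup i) (sym eq))
Unique⇒lookup-injective (_  ∷ u) {suc i} {suc j} eq = cong suc (Unique⇒lookup-injective u eq)

-- Each position of `xs` is sent to a position of the same entry in `ys`, injectively. Both edge
-- counts below are compared with lists of incidences in this way.
Unique-⊆⇒length≤ : {xs ys : List A} → Unique xs → (∀ {x} → x ∈ xs → x ∈ ys) →
                   length xs ≤ length ys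
Unique-⊆⇒length≤ {xs = xs} u xs⊆ys =
  Fin.injective⇒≤ {f = λ i → index (xs⊆ys (∈-lookup {xs = xs} i))} λ eq →
    Unique⇒lookup-injective u (index-injective (setoid _) (xs⊆ys (∈-lookup _)) (xs⊆ys (∈-lookup _)) eq)

-- Codegrees in dense bipartite relations

-- Subtraction-free form of `(m - n)² ≥ 0`: raising both arguments by one adds `2 + 2m + 2n` to
-- either side.
2mn≤m²+n² : ∀ m n → 2 * (m * n) ≤ m * m + n * n
2mn≤m²+n² zero    n       = z≤n
2mn≤m²+n² (suc m) zero    = ≤-trans (≤-reflexive (cong (2 *_) (*-zeroʳ m))) z≤n
2mn≤m²+n² (suc m) (suc n) = begin
  2 * (suc m * suc n)                  ≡⟨ lhs m n ⟩
  2 * (m * n) + (2 + 2 * m + 2 * n)    ≤⟨ +-monoˡ-≤ _ (2mn≤m²+n² m n) ⟩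
  m * m + n * n + (2 + 2 * m + 2 * n)  ≡⟨ rhs m n ⟩
  suc m * suc m + suc n * suc n        ∎
  where
  open ≤-Reasoning
  lhs : ∀ m n → 2 * (suc m * suc n) ≡ 2 * (m * n) + (2 + 2 * m + 2 * n)
  lhs = solve-∀
  rhs : ∀ m n → m * m + n * n + (2 + 2 * m + 2 * n) ≡ suc m * suc m + suc n * suc n
  rhs = solve-∀

-- The arithmetic core of `dense-pair`. Eliminating `S` gives `4knσ ≤ 3Xn² + 2k²σ`. With
-- `n = 2k + z` the left side is `(3n + z)kσ + 2k²σ`, so `(3n + z)kσ ≤ 3Xn²`, whereas density makes
-- `(3n + z)kσ` at least `(3n + z)Xn`, which is larger.
second-moment-gap : ∀ k n X σ S → 0 < X → 2 * k < n → X * n ≤ k * σ →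
  2 * (k * n) * σ ≤ k * k * S + X * (n * n) → ¬ (2 * k * k * S ≤ n * (n * X) + 2 * k * k * σ)
second-moment-gap k n X σ S 0<X 2k<n dense cauchy-schwarz KS≤ =
  -- The slack `z = n - 2k` enters through an equation, so that all later identities are free of
  -- truncated subtraction.
  gap (n ∸ 2 * k) (sym (m+[n∸m]≡n (<⇒≤ 2k<n))) (m<n⇒0<n∸m 2k<n)
  where
  open ≤-Reasoning

  split : ∀ k n z σ → (3 * n + z) * (k * σ) + 2 * k * k * σ ≡ (3 * n + (2 * k + z)) * (k * σ)
  split = solve-∀
  double : ∀ n k σ → (3 * n + n) * (k * σ) ≡ 2 * (2 * (k * n) * σ)
  double = solve-∀
  expand : ∀ k S X n → 2 * (k * k * S + X * (n * n)) ≡ 2 * k * k * S + 2 * (X * (n * n))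
  expand = solve-∀
  collect : ∀ n X t → n * (n * X) + t + 2 * (X * (n * n)) ≡ 3 * (X * (n * n)) + t
  collect = solve-∀
  factor : ∀ X n z → 3 * (X * (n * n)) + z * (X * n) ≡ (3 * n + z) * (X * n)
  factor = solve-∀

  module _ (z : ℕ) (n≡ : n ≡ 2 * k + z) (0<z : 0 < z) where
    upper : (3 * n + z) * (k * σ) + 2 * k * k * σ ≤ 3 * (X * (n * n)) + 2 * k * k * σ
    upper = begin
      (3 * n + z) * (k * σ) + 2 * k * k * σ              ≡⟨ split k n z σ ⟩
      (3 * n + (2 * k + z)) * (k * σ)                    ≡⟨ cong (λ t → (3 * n + t) * (k * σ)) n≡ ⟨
      (3 * n + n) * (k * σ)                              ≡⟨ double n k σ ⟩
      2 * (2 * (k * n) * σ)                              ≤⟨ *-monoʳ-≤ 2 cauchy-schwarz ⟩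
      2 * (k * k * S + X * (n * n))                      ≡⟨ expand k S X n ⟩
      2 * k * k * S + 2 * (X * (n * n))                  ≤⟨ +-monoˡ-≤ (2 * (X * (n * n))) KS≤ ⟩
      n * (n * X) + 2 * k * k * σ + 2 * (X * (n * n))    ≡⟨ collect n X (2 * k * k * σ) ⟩
      3 * (X * (n * n)) + 2 * k * k * σ                  ∎

    lower : 3 * (X * (n * n)) < (3 * n + z) * (k * σ)
    lower = begin-strict
      3 * (X * (n * n))                  <⟨ m<m+n (3 * (X * (n * n))) (*-mono-≤ 0<z (*-mono-≤ 0<X (≤-<-trans z≤n 2k<n))) ⟩
      3 * (X * (n * n)) + z * (X * n)    ≡⟨ factor X n z ⟩
      (3 * n + z) * (X * n)              ≤⟨ *-monoʳ-≤ (3 * n + z) dense ⟩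
      (3 * n + z) * (k * σ)              ∎

    gap : ⊥
    gap = <⇒≱ lower (+-cancelʳ-≤ (2 * k * k * σ) _ _ upper)

-- Otherwise Σ_x deg(x)² = Σ_{a,b} codeg(a,b) would be too small: with
-- X = |xs|, the degrees average at least n/k, so Σ_x deg(x)² is at least
-- roughly X(n/k)², whereas the off-diagonal pairs contribute at most n²X/2k².
dense-pair : {R : A → Fin n → Set} (R? : ∀ x a → Dec (R x a)) (xs : List A) →
  0 < length xs → 2 * k < n →
  length xs * n ≤ k * ∑ xs (λ x → ∑ (allFin n) λ a → 𝟙 (R? x a)) →
  ∃₂ λ a b → a ≢ b × length xs < 2 * k * k * ∑ xs (λ x → 𝟙 (R? x a ×-dec R? x b))
dense-pair {n = n} {k = k} R? xs 0<X 2k<n dense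
  -- The search is finite and decidable; if it fails, every off-diagonal codegree is small.
  with any? (λ a → any? λ b → ¬? (a Fin.≟ b) ×-dec
              (length xs <? 2 * k * k * ∑ xs (λ x → 𝟙 (R? x a ×-dec R? x b))))
... | yes found = found
... | no none = ⊥-elim (second-moment-gap k n X σ S 0<X 2k<n dense cauchy-schwarz KS≤)
  where
  open ≤-Reasoning
  X K σ S : ℕ
  X = length xs
  K = 2 * k * k
  Y = allFin n
  r : _ → Fin n → ℕ
  r x a = 𝟙 (R? x a)
  s : _ → ℕ
  s x = ∑ Y (r x)
  σ = ∑ xs s
  S = ∑ xs (λ x → s x * s x)
  deg : Fin n → ℕ
  deg a = ∑ xs (λ x → r x a)
  codeg : Fin n → Fin n → ℕ
  codeg a b = ∑ xs (λ x → 𝟙 (R? x a ×-dec R? x b))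

  -- The failed search says nothing about `a = b`; there the codegree is at most the degree of `a`.
  codeg-bound : ∀ a b → K * codeg a b ≤ X + 𝟙 (a Fin.≟ b) * (K * deg a)
  codeg-bound a b with a Fin.≟ b
  ... | no a≢b = ≤-trans (≮⇒≥ λ lt → none (a , b , a≢b , lt)) (m≤m+n X 0)
  ... | yes refl = begin
    K * codeg a a           ≤⟨ *-monoʳ-≤ K (∑-mono xs λ x → begin
      𝟙 (R? x a ×-dec R? x a)  ≡⟨ 𝟙-× (R? x a) (R? x a) ⟩
      r x a * r x a            ≤⟨ *-monoʳ-≤ (r x a) (𝟙≤1 (R? x a)) ⟩
      r x a * 1                ≡⟨ *-identityʳ (r x a) ⟩
      r x a                    ∎) ⟩
    K * deg a               ≡⟨ *-identityˡ _ ⟨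
    1 * (K * deg a)         ≤⟨ m≤n+m _ X ⟩
    X + 1 * (K * deg a)     ∎

  ∑codeg-bound : ∀ a → ∑ Y (λ b → K * codeg a b) ≤ n * X + K * deg a
  ∑codeg-bound a = begin
    ∑ Y (λ b → K * codeg a b)                             ≤⟨ ∑-mono Y (codeg-bound a) ⟩
    ∑ Y (λ b → X + 𝟙 (a Fin.≟ b) * (K * deg a))           ≡⟨ ∑-+ Y (λ _ → X) _ ⟩
    ∑ Y (λ _ → X) + ∑ Y (λ b → 𝟙 (a Fin.≟ b) * (K * deg a))
      ≡⟨ cong₂ _+_ (∑-allFin-const n X) (∑-*ʳ Y _ (K * deg a)) ⟩
    n * X + ∑ Y (λ b → 𝟙 (a Fin.≟ b)) * (K * deg a)       ≤⟨ +-monoʳ-≤ (n * X) (*-monoˡ-≤ (K * deg a) (∑-𝟙≟ a)) ⟩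
    n * X + 1 * (K * deg a)                               ≡⟨ cong (n * X +_) (*-identityˡ _) ⟩
    n * X + K * deg a                                     ∎

  S≡∑codeg : S ≡ ∑ Y (λ a → ∑ Y (λ b → codeg a b))
  S≡∑codeg = begin-equality
    ∑ xs (λ x → s x * s x)
      ≡⟨ ∑-cong xs (λ x → trans (sym (∑-*ʳ Y (r x) (s x))) (∑-cong Y λ a →
           trans (sym (∑-*ˡ Y (r x a) (r x))) (∑-cong Y λ b → sym (𝟙-× (R? x a) (R? x b))))) ⟩
    ∑ xs (λ x → ∑ Y λ a → ∑ Y λ b → 𝟙 (R? x a ×-dec R? x b))
      ≡⟨ ∑-swap xs Y _ ⟩
    ∑ Y (λ a → ∑ xs λ x → ∑ Y λ b → 𝟙 (R? x a ×-dec R? x b))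
      ≡⟨ ∑-cong Y (λ a → ∑-swap xs Y _) ⟩
    ∑ Y (λ a → ∑ Y (λ b → codeg a b)) ∎

  KS≤ : K * S ≤ n * (n * X) + K * σ
  KS≤ = begin
    K * S                                    ≡⟨ cong (K *_) S≡∑codeg ⟩
    K * ∑ Y (λ a → ∑ Y (λ b → codeg a b))    ≡⟨ ∑-*ˡ Y K _ ⟨
    ∑ Y (λ a → K * ∑ Y (λ b → codeg a b))    ≡⟨ ∑-cong Y (λ a → sym (∑-*ˡ Y K _)) ⟩
    ∑ Y (λ a → ∑ Y (λ b → K * codeg a b))    ≤⟨ ∑-mono Y ∑codeg-bound ⟩
    ∑ Y (λ a → n * X + K * deg a)            ≡⟨ ∑-+ Y (λ _ → n * X) _ ⟩
    ∑ Y (λ _ → n * X) + ∑ Y (λ a → K * deg a)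
      ≡⟨ cong₂ _+_ (∑-allFin-const n (n * X)) (∑-*ˡ Y K deg) ⟩
    n * (n * X) + K * ∑ Y deg                ≡⟨ cong (λ t → n * (n * X) + K * t) (∑-swap xs Y r) ⟨
    n * (n * X) + K * σ                      ∎

  -- Cauchy-Schwarz without division: `(k s(x) - n)² ≥ 0`, the tangent to the square at the
  -- reference degree `n/k`, summed over `xs`.
  cauchy-schwarz : 2 * (k * n) * σ ≤ k * k * S + X * (n * n)
  cauchy-schwarz = begin
    2 * (k * n) * σ                                    ≡⟨ ∑-*ˡ xs (2 * (k * n)) s ⟨
    ∑ xs (λ x → 2 * (k * n) * s x)                     ≤⟨ ∑-mono xs (λ x → begin
      2 * (k * n) * s x                  ≡⟨ regroup k n (s x) ⟩
      2 * (k * s x * n)                  ≤⟨ 2mn≤m²+n² (k * s x) n ⟩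
      k * s x * (k * s x) + n * n        ≡⟨ cong (_+ n * n) (square k (s x)) ⟩
      k * k * (s x * s x) + n * n        ∎) ⟩
    ∑ xs (λ x → k * k * (s x * s x) + n * n)           ≡⟨ ∑-+ xs _ (λ _ → n * n) ⟩
    ∑ xs (λ x → k * k * (s x * s x)) + ∑ xs (λ _ → n * n) ≡⟨ cong₂ _+_ (∑-*ˡ xs (k * k) _) (∑-const xs (n * n)) ⟩
    k * k * S + X * (n * n)                            ∎
    where
    regroup : ∀ k n t → 2 * (k * n) * t ≡ 2 * (k * t * n)
    regroup = solve-∀
    square : ∀ k t → k * t * (k * t) ≡ k * k * (t * t)
    square = solve-∀

-- The grid [n]^d

grid : ∀ n d → List (Vec (Fin n) d)
grid n zero    = [] ∷ []
grid n (suc d) = cartesianProductWith _∷_ (allFin n) (grid n d)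

length-grid : ∀ n d → length (grid n d) ≡ n ^ d
length-grid n zero    = refl
length-grid n (suc d) =
  trans (length-cartesianProductWith _∷_ (allFin n) (grid n d))
        (cong₂ _*_ (length-allFin n) (length-grid n d))

∈-grid : (v : Vec (Fin n) d) → v ∈ grid n d
∈-grid []      = here refl
∈-grid (x ∷ v) = ∈-cartesianProductWith⁺ _∷_ (∈-allFin x) (∈-grid v)

grid-Unique : ∀ n d → Unique (grid n d)
grid-Unique n zero    = [] ∷ []
grid-Unique n (suc d) =
  Unique.cartesianProductWith⁺ _∷_ Vec.∷-injective (Unique.allFin⁺ n) (grid-Unique n d)

-- A point is reached from exactly the `n` base points on its line in direction `a`, so it is
-- counted `n` times.
∑-grid-line : (a : Fin d) (f : Vec (Fin n) d → ℕ) →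
  ∑ (grid n d) (λ v → ∑ (allFin n) λ x → f (v [ a ]≔ x)) ≡ n * ∑ (grid n d) f
∑-grid-line {suc d} {n} zero f = begin
  ∑ (grid n (suc d)) (λ v → ∑ I λ x → f (v [ 0F ]≔ x))
    ≡⟨ ∑-cartesianProductWith _∷_ I (grid n d) _ ⟩
  ∑ I (λ _ → ∑ (grid n d) λ v → ∑ I λ x → f (x ∷ v))
    ≡⟨ ∑-allFin-const n _ ⟩
  n * ∑ (grid n d) (λ v → ∑ I λ x → f (x ∷ v))
    ≡⟨ cong (n *_) (∑-swap (grid n d) I _) ⟩
  n * ∑ I (λ x → ∑ (grid n d) λ v → f (x ∷ v))
    ≡⟨ cong (n *_) (∑-cartesianProductWith _∷_ I (grid n d) f) ⟨
  n * ∑ (grid n (suc d)) f ∎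
  where
  open ≡-Reasoning
  I = allFin n
∑-grid-line {suc d} {n} (suc a) f = begin
  ∑ (grid n (suc d)) (λ v → ∑ I λ x → f (v [ suc a ]≔ x))
    ≡⟨ ∑-cartesianProductWith _∷_ I (grid n d) _ ⟩
  ∑ I (λ y → ∑ (grid n d) λ v → ∑ I λ x → f (y ∷ (v [ a ]≔ x)))
    ≡⟨ ∑-cong I (λ y → ∑-grid-line a (λ v → f (y ∷ v))) ⟩
  ∑ I (λ y → n * ∑ (grid n d) λ v → f (y ∷ v))
    ≡⟨ ∑-*ˡ I n _ ⟩
  n * ∑ I (λ y → ∑ (grid n d) λ v → f (y ∷ v))
    ≡⟨ cong (n *_) (∑-cartesianProductWith _∷_ I (grid n d) f) ⟨
  n * ∑ (grid n (suc d)) f ∎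
  where
  open ≡-Reasoning
  I = allFin n

-- Rectangles in dense subsets of the grid

record Rectangle {n d} (R : Vec (Fin n) d → Fin d → Set) : Set where
  field
    base    : Vec (Fin n) d
    a b     : Fin d
    a≢b     : a ≢ b
    x x′    : Fin n
    x≢x′    : x ≢ x′
    y y′    : Fin n
    y≢y′    : y ≢ y′
  corner : Fin n → Fin n → Vec (Fin n) d
  corner s t = (base [ a ]≔ s) [ b ]≔ t
  -- Each corner is related to the directions of both sides through it; over the four corners these
  -- are the eight edges of the future cycle.
  Corner : Fin n → Fin n → Set
  Corner s t = R (corner s t) a × R (corner s t) b
  field
    xy   : Corner x y
    xy′  : Corner x y′
    x′y  : Corner x′ y
    x′y′ : Corner x′ y′

-- Averaging: by `∑-grid-line`, used once for each direction, the plane sums over all base points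
-- add up to `n²` times the whole sum, so some plane is at least averagely dense.
dense-plane : ∀ K (a b : Fin d) (f : Vec (Fin n) d → ℕ) → 0 < n → length (grid n d) < K * ∑ (grid n d) f →
  ∃ λ v → n * n < K * ∑ (allFin n) λ s → ∑ (allFin n) λ t → f ((v [ a ]≔ s) [ b ]≔ t)
dense-plane {d} {n} K a b f 0<n dense = pigeonhole (grid n d) _ (n * n) (begin-strict
  length (grid n d) * (n * n)                        <⟨ *-monoˡ-< (n * n) {{>-nonZero (*-mono-≤ 0<n 0<n)}} dense ⟩
  K * ∑ (grid n d) f * (n * n)                       ≡⟨ regroup K _ n ⟩
  K * (n * (n * ∑ (grid n d) f))                     ≡⟨ cong (λ t → K * (n * t)) (∑-grid-line b f) ⟨
  K * (n * ∑ (grid n d) fᵇ)                          ≡⟨ cong (K *_) (∑-grid-line a fᵇ) ⟨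
  K * ∑ (grid n d) (λ v → ∑ (allFin n) λ s → fᵇ (v [ a ]≔ s))
                                                     ≡⟨ ∑-*ˡ (grid n d) K _ ⟨
  ∑ (grid n d) (λ v → K * ∑ (allFin n) λ s → fᵇ (v [ a ]≔ s)) ∎)
  where
  open ≤-Reasoning
  fᵇ : Vec (Fin n) d → ℕ
  fᵇ v = ∑ (allFin n) λ t → f (v [ b ]≔ t)
  regroup : ∀ K t n → K * t * (n * n) ≡ K * (n * (n * t))
  regroup = solve-∀

-- `dense-pair`, with the first coordinates as `xs`, finds two columns `y`, `y′` whose common rows
-- number more than `n / 2K²`.
planar-rectangle : ∀ K .{{_ : NonZero K}} → 2 * K * K < n → {Q : Fin n → Fin n → Set} (Q? : ∀ s t → Dec (Q s t)) →
  n * n < K * ∑ (allFin n) (λ s → ∑ (allFin n) λ t → 𝟙 (Q? s t)) →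
  ∃₂ λ y y′ → y ≢ y′ × ∃₂ λ x x′ → x ≢ x′ × (Q x y × Q x y′) × (Q x′ y × Q x′ y′)
planar-rectangle {n} K 2KK<n Q? dense
  with y , y′ , y≢y′ , yy′-dense ← dense-pair {k = K} Q? (allFin n)
         (subst (0 <_) (sym (length-allFin n)) (≤-<-trans z≤n 2KK<n))
         (≤-<-trans (m≤m*n (2 * K) K) 2KK<n)
         (≤-trans (≤-reflexive (cong (_* n) (length-allFin n))) (<⇒≤ dense))
  = y , y′ , y≢y′ , ∑𝟙-∃₂ (λ s → Q? s y ×-dec Q? s y′) (Unique.allFin⁺ n)
      -- As `n > 2K²`, there is more than one common row, which gives `x` and `x′`.
      (*-cancelˡ-< (2 * K * K) 1 _ (begin-strict
        2 * K * K * 1       ≡⟨ *-identityʳ (2 * K * K) ⟩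
        2 * K * K           <⟨ 2KK<n ⟩
        n                   ≡⟨ length-allFin n ⟨
        length (allFin n)   <⟨ yy′-dense ⟩
        2 * K * K * ∑ (allFin n) (λ s → 𝟙 (Q? s y ×-dec Q? s y′)) ∎))
  where open ≤-Reasoning

-- Some two directions a, b are both chosen at a positive proportion of the
-- points, hence at a positive proportion of some plane parallel to a and b;
-- a dense subset of this plane contains the corners of a rectangle.
rectangle : ∀ k .{{_ : NonZero k}} → let K = 2 * k * k in 2 * k < d → 2 * K * K < n →
  {R : Vec (Fin n) d → Fin d → Set} (R? : ∀ v a → Dec (R v a)) →
  n ^ d * d ≤ k * ∑ (grid n d) (λ v → ∑ (allFin d) λ a → 𝟙 (R? v a)) →
  Rectangle R
rectangle {d} {n} k@(suc _) 2k<d 2KK<n {R} R? dense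
  with a , b , a≢b , ab-dense ← dense-pair {k = k} R? (grid n d)
         (subst (0 <_) (sym (length-grid n d)) (m^n>0 n {{>-nonZero (≤-<-trans z≤n 2KK<n)}} d)) 2k<d
         (≤-trans (≤-reflexive (cong (_* d) (length-grid n d))) dense)
  -- The first count leaves density above `1 / 2k²`, so `2k²` takes the place of `k` in the planar
  -- count.
  with v , v-dense ← dense-plane (2 * k * k) a b (λ v → 𝟙 (R? v a ×-dec R? v b)) (≤-<-trans z≤n 2KK<n) ab-dense
  with y , y′ , y≢y′ , x , x′ , x≢x′ , (xy , xy′) , (x′y , x′y′) ← planar-rectangle (2 * k * k) 2KK<n
         (λ s t → let w = (v [ a ]≔ s) [ b ]≔ t in R? w a ×-dec R? w b) v-dense
  = record
    { base = v ; a = a ; b = b ; a≢b = a≢b ; x = x ; x′ = x′ ; x≢x′ = x≢x′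
    ; y = y ; y′ = y′ ; y≢y′ = y≢y′ ; xy = xy ; xy′ = xy′ ; x′y = x′y ; x′y′ = x′y′ }

-- `Next` as a function: a cycle then needs just one adjacency for each index.
rot : Fin (suc m) → Fin (suc m)
rot {m} i = suc (toℕ i) mod suc m

-- Closed walks along axis-parallel lines

-- Erasing coordinate `a` leaves a canonical name of the line in direction `a`; both points must
-- yield the same name.
Collinear : Fin d → Vec (Fin (suc n)) d → Vec (Fin (suc n)) d → Set
Collinear a p q = p [ a ]≔ 0F ≡ q [ a ]≔ 0F

collinear⇒lookup≡ : {a b : Fin d} {p q : Vec (Fin (suc n)) d} → a ≢ b → Collinear a p q →
                    Vec.lookup p b ≡ Vec.lookup q b
collinear⇒lookup≡ {a = a} {b} {p} {q} a≢b pq = begin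
  Vec.lookup p b               ≡⟨ Vec.lookup∘update′ (≢-sym a≢b) p 0F ⟨
  Vec.lookup (p [ a ]≔ 0F) b   ≡⟨ cong (λ v → Vec.lookup v b) pq ⟩
  Vec.lookup (q [ a ]≔ 0F) b   ≡⟨ Vec.lookup∘update′ (≢-sym a≢b) q 0F ⟩
  Vec.lookup q b               ∎
  where open ≡-Reasoning

collinear∧lookup≡⇒≡ : {a : Fin d} {p q : Vec (Fin (suc n)) d} → Collinear a p q →
                      Vec.lookup p a ≡ Vec.lookup q a → p ≡ q
collinear∧lookup≡⇒≡ {a = a} {p} {q} pq eq = trans (sym (restore p)) (trans (cong₂ (_[ a ]≔_) pq eq) (restore q))
  where
  restore : ∀ v → (v [ a ]≔ 0F) [ a ]≔ Vec.lookup v a ≡ v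
  restore v = trans (Vec.[]≔-idempotent v a) (Vec.[]≔-lookup v a)

-- If step 0 alone had direction `a₀`, the other four steps would preserve that coordinate. Going
-- back along them, `p₀` and `p₁` would agree in it, hence everywhere. The neighbouring steps are
-- excluded, leaving steps 2 and 3.
direction-repeats : {a₀ a₁ a₂ a₃ a₄ : Fin d} {p₀ p₁ p₂ p₃ p₄ : Vec (Fin (suc n)) d} →
  Collinear a₀ p₀ p₁ → Collinear a₁ p₁ p₂ → Collinear a₂ p₂ p₃ → Collinear a₃ p₃ p₄ → Collinear a₄ p₄ p₀ →
  p₀ ≢ p₁ → a₀ ≢ a₁ → a₄ ≢ a₀ → a₀ ≡ a₂ ⊎ a₀ ≡ a₃
direction-repeats {a₀ = a₀} {a₂ = a₂} {a₃} c₀ c₁ c₂ c₃ c₄ p₀≢p₁ a₀≢a₁ a₄≢a₀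
  with a₀ Fin.≟ a₂ | a₀ Fin.≟ a₃
... | yes eq | _      = inj₁ eq
... | no _   | yes eq = inj₂ eq
... | no ≢₂  | no ≢₃  = contradiction (collinear∧lookup≡⇒≡ c₀ (sym back)) p₀≢p₁
  where
  back = trans (collinear⇒lookup≡ (≢-sym a₀≢a₁) c₁)
        (trans (collinear⇒lookup≡ (≢-sym ≢₂) c₂)
        (trans (collinear⇒lookup≡ (≢-sym ≢₃) c₃)
               (collinear⇒lookup≡ a₄≢a₀ c₄)))

-- Every direction occurs at least twice, but at most twice among five cyclic steps whose neighbours
-- differ; five is odd.
no-pentagon : {a₀ a₁ a₂ a₃ a₄ : Fin d} {p₀ p₁ p₂ p₃ p₄ : Vec (Fin (suc n)) d} →
  Collinear a₀ p₀ p₁ → Collinear a₁ p₁ p₂ → Collinear a₂ p₂ p₃ → Collinear a₃ p₃ p₄ → Collinear a₄ p₄ p₀ →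
  p₀ ≢ p₁ → p₁ ≢ p₂ → p₂ ≢ p₃ → p₃ ≢ p₄ → p₄ ≢ p₀ →
  a₀ ≢ a₁ → a₁ ≢ a₂ → a₂ ≢ a₃ → a₃ ≢ a₄ → a₄ ≢ a₀ → ⊥
no-pentagon c₀ c₁ c₂ c₃ c₄ p₀₁ p₁₂ p₂₃ p₃₄ p₄₀ a₀₁ a₁₂ a₂₃ a₃₄ a₄₀
  with direction-repeats c₀ c₁ c₂ c₃ c₄ p₀₁ a₀₁ a₄₀
-- With steps 0 and 2 paired, steps 3 and 4 can both repeat only step 1, so these neighbours agree.
... | inj₁ refl with direction-repeats c₃ c₄ c₀ c₁ c₂ p₃₄ a₃₄ a₂₃ | direction-repeats c₄ c₀ c₁ c₂ c₃ p₄₀ a₄₀ a₃₄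
...   | inj₁ refl | _         = a₂₃ refl
...   | inj₂ _    | inj₂ refl = a₄₀ refl
...   | inj₂ refl | inj₁ refl = a₃₄ refl
no-pentagon c₀ c₁ c₂ c₃ c₄ p₀₁ p₁₂ p₂₃ p₃₄ p₄₀ a₀₁ a₁₂ a₂₃ a₃₄ a₄₀
    -- With steps 0 and 3 paired, steps 1 and 2 can both repeat only step 4.
    | inj₂ refl with direction-repeats c₁ c₂ c₃ c₄ c₀ p₁₂ a₁₂ a₀₁ | direction-repeats c₂ c₃ c₄ c₀ c₁ p₂₃ a₂₃ a₁₂
...   | inj₁ refl | _         = a₀₁ refl
...   | inj₂ _    | inj₂ refl = a₂₃ refl
...   | inj₂ refl | inj₁ refl = a₁₂ refl

-- Cyclic successors

next⇒rot : (i j : Fin 8) → Next i j → j ≡ rot i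
next⇒rot = from-yes (all? {8} λ i → all? {8} λ j → next? i j →-dec (j Fin.≟ rot i))

next-rot : (i : Fin 10) → Next i (rot i)
next-rot = from-yes (all? {10} λ i → next? i (rot i))

rot-injective : (i j : Fin 10) → rot i ≡ rot j → i ≡ j
rot-injective = from-yes (all? {10} λ i → all? {10} λ j → (rot i Fin.≟ rot j) →-dec (i Fin.≟ j))

copy-C8 : {G : Graph m} (H : Subgraph G) (e : Fin 8 → Fin m) → Injective _≡_ _≡_ e →
          (∀ i → Graph._~_ (Subgraph.edges H) (e i) (e (rot i))) → Copy (C 8) H
copy-C8 H e e-injective e-edge = record
  { embed     = e
  ; injective = e-injective
  ; vertex    = λ i → Subgraph.incident H (e-edge i)
  ; edge      = λ { (inj₁ next) → next⇒edge next ; (inj₂ next) → Graph.~-sym (Subgraph.edges H) (next⇒edge next) }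
  }
  where
  next⇒edge : ∀ {i j} → Next i j → Graph._~_ (Subgraph.edges H) (e i) (e j)
  next⇒edge {i} {j} next rewrite next⇒rot i j next = e-edge i

-- The incidence graph of the points and the axis-parallel lines of the grid

module Incidence (ℓ₀ d : ℕ) where

  -- The side is a successor so that `0F` exists as the value of an erased coordinate.
  ℓ N : ℕ
  ℓ = suc ℓ₀
  N = suc d * ℓ ^ d

  Point : Set
  Point = Vec (Fin ℓ) d

  -- (zero , p) is the point p; (suc a , q) with q_a = 0 is the line through q
  -- in direction a. The remaining pairs are isolated vertices.
  Vertex : Set
  Vertex = Fin (suc d) × Point

  encodePoint : ∀ {e} → Vec (Fin ℓ) e → Fin (ℓ ^ e)
  encodePoint []      = zero
  encodePoint (x ∷ v) = combine x (encodePoint v)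

  decodePoint : ∀ {e} → Fin (ℓ ^ e) → Vec (Fin ℓ) e
  decodePoint {zero}  _ = []
  decodePoint {suc e} i = proj₁ (remQuot {ℓ} (ℓ ^ e) i) ∷ decodePoint (proj₂ (remQuot {ℓ} (ℓ ^ e) i))

  decode∘encodePoint : ∀ {e} (v : Vec (Fin ℓ) e) → decodePoint (encodePoint v) ≡ v
  decode∘encodePoint []      = refl
  decode∘encodePoint {suc e} (x ∷ v) = trans
    (cong (λ r → proj₁ r ∷ decodePoint {e} (proj₂ r)) (Fin.remQuot-combine {ℓ} {ℓ ^ e} x (encodePoint v)))
    (cong (x ∷_) (decode∘encodePoint v))

  encode∘decodePoint : ∀ {e} (i : Fin (ℓ ^ e)) → encodePoint {e} (decodePoint i) ≡ i
  encode∘decodePoint {zero}  zero = refl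
  encode∘decodePoint {suc e} i = trans
    (cong (combine (proj₁ (remQuot {ℓ} (ℓ ^ e) i))) (encode∘decodePoint {e} (proj₂ (remQuot {ℓ} (ℓ ^ e) i))))
    (Fin.combine-remQuot {ℓ} (ℓ ^ e) i)

  -- The kind of vertex is the leading digit, so all points precede all lines; this fits the
  -- convention `i < j` of `∣E_∣`.
  encode : Vertex → Fin N
  encode (s , v) = combine s (encodePoint v)

  decode : Fin N → Vertex
  decode i = proj₁ (remQuot {suc d} (ℓ ^ d) i) , decodePoint (proj₂ (remQuot {suc d} (ℓ ^ d) i))

  decode∘encode : ∀ u → decode (encode u) ≡ u
  decode∘encode (s , v) = trans
    (cong (λ r → proj₁ r , decodePoint {d} (proj₂ r)) (Fin.remQuot-combine {suc d} {ℓ ^ d} s (encodePoint v)))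
    (cong (s ,_) (decode∘encodePoint v))

  encode∘decode : ∀ i → encode (decode i) ≡ i
  encode∘decode i = trans
    (cong (combine (proj₁ (remQuot {suc d} (ℓ ^ d) i))) (encode∘decodePoint {d} (proj₂ (remQuot {suc d} (ℓ ^ d) i))))
    (Fin.combine-remQuot {suc d} (ℓ ^ d) i)

  encode-injective : ∀ {u v} → encode u ≡ encode v → u ≡ v
  encode-injective {u} {v} eq = trans (sym (decode∘encode u)) (trans (cong decode eq) (decode∘encode v))

  decode-injective : ∀ {i j} → decode i ≡ decode j → i ≡ j
  decode-injective {i} {j} eq = trans (sym (encode∘decode i)) (trans (cong encode eq) (encode∘decode j))

  point : Point → Vertex
  point p = zero , p

  line : Fin d → Point → Vertex
  line a p = suc a , p [ a ]≔ 0F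

  -- The equation is an argument of `on`, which keeps computed vectors out of the indices and
  -- pattern matching easy.
  data On : Vertex → Vertex → Set where
    on : ∀ {p a q} → q ≡ p [ a ]≔ 0F → On (zero , p) (suc a , q)

  on? : ∀ u v → Dec (On u v)
  on? (suc _ , _) _           = no λ ()
  on? (zero , _)  (zero , _)  = no λ ()
  on? (zero , p)  (suc a , q) with Vec.≡-dec Fin._≟_ q (p [ a ]≔ 0F)
  ... | yes eq = yes (on eq)
  ... | no neq = no λ { (on eq) → neq eq }

  Adjacent : Vertex → Vertex → Set
  Adjacent u v = On u v ⊎ On v u

  graph : Graph N
  graph = record
    { _~_      = λ i j → Adjacent (decode i) (decode j)
    ; _~?_     = λ i j → on? (decode i) (decode j) ⊎-dec on? (decode j) (decode i)
    ; ~-sym    = swap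
    ; ~-irrefl = λ { {i} refl → [ irrefl , irrefl ] }
    }
    where
    irrefl : ∀ {u} → ¬ On u u
    irrefl ()

  bipartite : Bipartite graph
  bipartite = isPoint ∘ decode , separated
    where
    isPoint : Vertex → Bool
    isPoint (zero , _)  = true
    isPoint (suc _ , _) = false
    separated : ∀ {u v} → Adjacent u v → isPoint u ≢ isPoint v
    separated (inj₁ (on _)) ()
    separated (inj₂ (on _)) ()

  -- From a point an edge leads to a line and the next one back to a point: two edges of the graph
  -- form one move of the walk.
  two-steps : ∀ {u v w p} → u ≡ point p → Adjacent u v → Adjacent v w →
              ∃₂ λ a q → v ≡ line a p × w ≡ point q × Collinear a p q
  two-steps refl (inj₁ (on refl)) (inj₂ (on eq)) = _ , _ , refl , refl , eq

  -- Consecutive moves in one direction run along the same line, a repetition that no cycle permits.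
  line-cong : ∀ {a b p q r} → Collinear a p q → a ≡ b → r ≡ line b q → r ≡ line a p
  line-cong pq refl r≡ = trans r≡ (cong (_ ,_) (sym pq))

  no-decagon-from-point : (w : Fin 10 → Vertex) → Injective _≡_ _≡_ w → (∀ i → Adjacent (w i) (w (rot i))) →
                          ∀ p → ¬ (w 0F ≡ point p)
  no-decagon-from-point w w-injective w-adjacent p₀ e₀
    with a₀ , p₁ , l₀ , e₁ , c₀ ← two-steps e₀ (w-adjacent 0F) (w-adjacent 1F)
    with a₁ , p₂ , l₁ , e₂ , c₁ ← two-steps e₁ (w-adjacent 2F) (w-adjacent 3F)
    with a₂ , p₃ , l₂ , e₃ , c₂ ← two-steps e₂ (w-adjacent 4F) (w-adjacent 5F)
    with a₃ , p₄ , l₃ , e₄ , c₃ ← two-steps e₃ (w-adjacent 6F) (w-adjacent 7F)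
    with a₄ , _  , l₄ , e₅ , c₄ ← two-steps e₄ (w-adjacent 8F) (w-adjacent 9F)
    -- `rot 9F` computes to `0F`, so the fifth move ends at the starting point.
    with refl ← trans (sym e₀) e₅
    = no-pentagon c₀ c₁ c₂ c₃ c₄
        (points≢ e₀ e₁ λ ()) (points≢ e₁ e₂ λ ()) (points≢ e₂ e₃ λ ()) (points≢ e₃ e₄ λ ()) (points≢ e₄ e₀ λ ())
        (lines≢ c₀ l₀ l₁ λ ()) (lines≢ c₁ l₁ l₂ λ ()) (lines≢ c₂ l₂ l₃ λ ())
        (lines≢ c₃ l₃ l₄ λ ()) (lines≢ c₄ l₄ l₀ λ ())
    where
    points≢ : ∀ {i j p q} → w i ≡ point p → w j ≡ point q → i ≢ j → p ≢ q
    points≢ ei ej i≢j refl = i≢j (w-injective (trans ei (sym ej)))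
    lines≢ : ∀ {i j a b p q} → Collinear a p q → w i ≡ line a p → w j ≡ line b q → i ≢ j → a ≢ b
    lines≢ pq li lj i≢j a≡b = i≢j (w-injective (trans li (sym (line-cong pq a≡b lj))))

  C10-free : (C 10 -Free) graph
  C10-free copy = from (w 0F) refl
    where
    open Copy copy
    w : Fin 10 → Vertex
    w i = decode (embed i)
    w-injective : Injective _≡_ _≡_ w
    w-injective eq = injective (decode-injective eq)
    w-adjacent : ∀ i → Adjacent (w i) (w (rot i))
    w-adjacent i = edge (inj₁ (next-rot i))
    from : ∀ u → w 0F ≡ u → ⊥
    from (zero , p)  eq = no-decagon-from-point w w-injective w-adjacent p eq
    -- A cycle that starts at a line is shifted by one place; its second vertex is a point.
    from (suc a , q) eq with w 0F | w 1F in eq₁ | w-adjacent 0F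
    from (suc a , q) refl | _ | _ | inj₂ (on {p = p} _) =
      no-decagon-from-point (w ∘ rot) (λ {i} {j} eq → rot-injective i j (w-injective eq)) (w-adjacent ∘ rot) p eq₁

  -- Edges as pairs of a point and a direction

  incidence : Point × Fin d → Fin N × Fin N
  incidence (p , a) = encode (point p) , encode (line a p)

  incidence-injective : ∀ {s t} → incidence s ≡ incidence t → s ≡ t
  incidence-injective {p , a} {q , b} eq
    with refl ← encode-injective {point p} {point q} (cong proj₁ eq)
    with refl ← cong proj₁ (encode-injective {line a p} {line b p} (cong proj₂ eq)) = refl

  adjacent-incidence : ∀ p a → Graph._~_ graph (encode (point p)) (encode (line a p))
  adjacent-incidence p a =
    subst₂ Adjacent (sym (decode∘encode (point p))) (sym (decode∘encode (line a p))) (inj₁ (on refl))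

  encode-< : ∀ p a q → encode (zero , p) Fin.< encode (suc a , q)
  encode-< p a q = Fin.combine-monoˡ-< {i = zero} {j = suc a} (encodePoint p) (encodePoint q) (s≤s z≤n)

  on⇒< : ∀ i j → On (decode i) (decode j) → i Fin.< j
  on⇒< i j o = subst₂ Fin._<_ (encode∘decode i) (encode∘decode j) (go o)
    where
    go : ∀ {u v} → On u v → encode u Fin.< encode v
    go (on {p} {a} {q} _) = encode-< p a q

  on⇒incidence : ∀ {u v} → On u v → ∃₂ λ p a → u ≡ point p × v ≡ line a p
  on⇒incidence (on refl) = _ , _ , refl , refl

  -- Lines come after points in the numbering, so `i < j` forces `i` to be the point and each
  -- incidence is counted once.
  edge⇒incidence : ∀ i j → i Fin.< j → Graph._~_ graph i j → ∃₂ λ p a → (i , j) ≡ incidence (p , a)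
  edge⇒incidence i j i<j (inj₂ o) = contradiction i<j (<-asym (on⇒< j i o))
  edge⇒incidence i j i<j (inj₁ o) with p , a , eq , eq′ ← on⇒incidence o =
    p , a , cong₂ _,_ (trans (sym (encode∘decode i)) (cong encode eq)) (trans (sym (encode∘decode j)) (cong encode eq′))

  ∣E∣≥ : ℓ ^ d * d ≤ ∣E graph ∣
  ∣E∣≥ = begin
    ℓ ^ d * d                                  ≡⟨ cong₂ _*_ (length-grid ℓ d) (length-allFin d) ⟨
    length (grid ℓ d) * length (allFin d)      ≡⟨ length-cartesianProductWith _,_ (grid ℓ d) (allFin d) ⟨
    length pairs                               ≡⟨ List.length-map incidence pairs ⟨
    length (map incidence pairs)               ≤⟨ Unique-⊆⇒length≤
      (Unique.map⁺ incidence-injective (Unique.cartesianProduct⁺ (grid-Unique ℓ d) (Unique.allFin⁺ d))) ⊆edges ⟩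
    ∣E graph ∣                                 ∎
    where
    open ≤-Reasoning
    pairs = cartesianProduct (grid ℓ d) (allFin d)
    ⊆edges : ∀ {ij} → ij ∈ map incidence pairs → ij ∈ filter _ (cartesianProduct (allFin N) (allFin N))
    ⊆edges ij∈ with (p , a) , _ , refl ← ∈-map⁻ incidence ij∈ =
      ∈-filter⁺ _ (∈-cartesianProduct⁺ (∈-allFin _) (∈-allFin _)) (encode-< p a (p [ a ]≔ 0F) , adjacent-incidence p a)

  -- Eight-cycles in dense subgraphs

  module _ (H : Subgraph graph) where
    open Subgraph H

    Kept : Point → Fin d → Set
    Kept p a = Graph._~_ edges (encode (point p)) (encode (line a p))

    kept? : ∀ p a → Dec (Kept p a)
    kept? p a = Graph._~?_ edges (encode (point p)) (encode (line a p))

    ∣E∣≤ : ∣E edges ∣ ≤ ∑ (grid ℓ d) (λ p → ∑ (allFin d) λ a → 𝟙 (kept? p a))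
    ∣E∣≤ = begin
      ∣E edges ∣                                     ≤⟨ Unique-⊆⇒length≤
        (Unique.filter⁺ _ (Unique.cartesianProduct⁺ (Unique.allFin⁺ N) (Unique.allFin⁺ N))) edges⊆incidences ⟩
      length (map incidence (filter (uncurry kept?) pairs))  ≡⟨ List.length-map incidence (filter (uncurry kept?) pairs) ⟩
      length (filter (uncurry kept?) pairs)          ≡⟨ length-filter-∑ (uncurry kept?) pairs ⟩
      ∑ pairs (λ s → 𝟙 (uncurry kept? s))            ≡⟨ ∑-cartesianProductWith _,_ (grid ℓ d) (allFin d) _ ⟩
      ∑ (grid ℓ d) (λ p → ∑ (allFin d) λ a → 𝟙 (kept? p a)) ∎
      where
      open ≤-Reasoning
      pairs = cartesianProduct (grid ℓ d) (allFin d)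
      edges⊆incidences : ∀ {ij} → ij ∈ filter _ (cartesianProduct (allFin N) (allFin N)) →
                         ij ∈ map incidence (filter (uncurry kept?) pairs)
      edges⊆incidences {i , j} ij∈
        with _ , i<j , i~j ← ∈-filter⁻ (λ (i , j) → (i Fin.<? j) ×-dec (Graph._~?_ edges i j))
                               {xs = cartesianProduct (allFin N) (allFin N)} ij∈
        with p , a , refl ← edge⇒incidence i j i<j (edges⊆ i~j)
        = ∈-map⁺ incidence (∈-filter⁺ (uncurry kept?) (∈-cartesianProduct⁺ (∈-grid p) (∈-allFin a)) i~j)

    rectangle⇒C8 : Rectangle Kept → Copy (C 8) H
    rectangle⇒C8 rect = copy-C8 H (λ i → encode (lookup octagon i))
      (λ eq → Unique⇒lookup-injective octagon-Unique (encode-injective eq)) octagon-edge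
      where
      open Rectangle rect
      open Graph edges using (_~_; ~-sym)

      -- A side is named by the coordinate it fixes, so that both corners on it lead to the same
      -- vertex.
      lineᵃ lineᵇ : Fin ℓ → Vertex
      lineᵃ t = suc a , (base [ a ]≔ 0F) [ b ]≔ t
      lineᵇ s = suc b , (base [ a ]≔ s) [ b ]≔ 0F

      line-a : ∀ s t → line a (corner s t) ≡ lineᵃ t
      line-a s t = cong (suc a ,_) (begin
        ((base [ a ]≔ s) [ b ]≔ t) [ a ]≔ 0F   ≡⟨ Vec.[]≔-commutes (base [ a ]≔ s) b a (≢-sym a≢b) ⟩
        ((base [ a ]≔ s) [ a ]≔ 0F) [ b ]≔ t   ≡⟨ cong (_[ b ]≔ t) (Vec.[]≔-idempotent base a) ⟩
        (base [ a ]≔ 0F) [ b ]≔ t              ∎)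
        where open ≡-Reasoning

      line-b : ∀ s t → line b (corner s t) ≡ lineᵇ s
      line-b s t = cong (suc b ,_) (Vec.[]≔-idempotent (base [ a ]≔ s) b)

      edgeᵃ : ∀ {s t} → Corner s t → encode (point (corner s t)) ~ encode (lineᵃ t)
      edgeᵃ {s} {t} (kept , _) = subst (λ v → encode (point (corner s t)) ~ encode v) (line-a s t) kept

      edgeᵇ : ∀ {s t} → Corner s t → encode (point (corner s t)) ~ encode (lineᵇ s)
      edgeᵇ {s} {t} (_ , kept) = subst (λ v → encode (point (corner s t)) ~ encode v) (line-b s t) kept

      coordᵃ : ∀ s t → Vec.lookup (corner s t) a ≡ s
      coordᵃ s t = trans (Vec.lookup∘update′ a≢b (base [ a ]≔ s) t) (Vec.lookup∘update a base s)

      coordᵇ : ∀ s t → Vec.lookup (corner s t) b ≡ t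
      coordᵇ s t = Vec.lookup∘update b (base [ a ]≔ s) t

      -- This covers sides as well as corners: `lineᵃ t` unfolds to `corner 0F t` and `lineᵇ s` to
      -- `corner s 0F`, hence the arbitrary tags `i`, `j`.
      ≢ᵃ : ∀ {i j : Fin (suc d)} {s s′ t t′} → s ≢ s′ → (i , corner s t) ≢ (j , corner s′ t′)
      ≢ᵃ {s = s} {s′} {t} {t′} s≢s′ eq = s≢s′ (trans (sym (coordᵃ s t))
        (trans (cong (λ v → Vec.lookup (proj₂ v) a) eq) (coordᵃ s′ t′)))

      ≢ᵇ : ∀ {i j : Fin (suc d)} {s s′ t t′} → t ≢ t′ → (i , corner s t) ≢ (j , corner s′ t′)
      ≢ᵇ {s = s} {s′} {t} {t′} t≢t′ eq = t≢t′ (trans (sym (coordᵇ s t))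
        (trans (cong (λ v → Vec.lookup (proj₂ v) b) eq) (coordᵇ s′ t′)))

      b≢a-lines : ∀ {s t} → lineᵇ s ≢ lineᵃ t
      b≢a-lines eq = a≢b (sym (Fin.suc-injective (cong proj₁ eq)))

      -- The tour of the rectangle: corners alternate with the sides joining them.
      octagon : List Vertex
      octagon = point (corner x y) ∷ lineᵇ x ∷ point (corner x y′) ∷ lineᵃ y′ ∷
                point (corner x′ y′) ∷ lineᵇ x′ ∷ point (corner x′ y) ∷ lineᵃ y ∷ []

      octagon-Unique : Unique octagon
      octagon-Unique =
          ((λ ()) ∷ ≢ᵇ y≢y′ ∷ (λ ()) ∷ ≢ᵃ x≢x′ ∷ (λ ()) ∷ ≢ᵃ x≢x′ ∷ (λ ()) ∷ [])
        ∷ ((λ ()) ∷ b≢a-lines ∷ (λ ()) ∷ ≢ᵃ x≢x′ ∷ (λ ()) ∷ b≢a-lines ∷ [])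
        ∷ ((λ ()) ∷ ≢ᵃ x≢x′ ∷ (λ ()) ∷ ≢ᵃ x≢x′ ∷ (λ ()) ∷ [])
        ∷ ((λ ()) ∷ ≢-sym b≢a-lines ∷ (λ ()) ∷ ≢ᵇ (≢-sym y≢y′) ∷ [])
        ∷ ((λ ()) ∷ ≢ᵇ (≢-sym y≢y′) ∷ (λ ()) ∷ [])
        ∷ ((λ ()) ∷ b≢a-lines ∷ [])
        ∷ ((λ ()) ∷ [])
        ∷ [] ∷ []

      octagon-edge : ∀ i → encode (lookup octagon i) ~ encode (lookup octagon (rot i))
      octagon-edge 0F = edgeᵇ xy
      octagon-edge 1F = ~-sym (edgeᵇ xy′)
      octagon-edge 2F = edgeᵃ xy′
      octagon-edge 3F = ~-sym (edgeᵃ x′y′)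
      octagon-edge 4F = edgeᵇ x′y′
      octagon-edge 5F = ~-sym (edgeᵇ x′y)
      octagon-edge 6F = edgeᵃ x′y
      octagon-edge 7F = ~-sym (edgeᵃ xy)

  -- Density passes from edges to incidences: `G` has at least `ℓ^d * d` edges, and `H` has at most
  -- as many edges as kept incidences.
  dense⇒C8 : ∀ k .{{_ : NonZero k}} → let K = 2 * k * k in 2 * k < d → 2 * K * K < ℓ →
    (H : Subgraph graph) → ∣E graph ∣ ≤ k * ∣E Subgraph.edges H ∣ → Copy (C 8) H
  dense⇒C8 k 2k<d 2KK<ℓ H dense = rectangle⇒C8 H (rectangle k 2k<d 2KK<ℓ (kept? H)
    (≤-trans ∣E∣≥ (≤-trans dense (*-monoʳ-≤ k (∣E∣≤ H)))))

  ℓ≤N : 0 < d → ℓ ≤ N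
  ℓ≤N 0<d = begin
    ℓ        ≡⟨ *-identityʳ ℓ ⟨
    ℓ ^ 1    ≤⟨ ^-monoʳ-≤ ℓ 0<d ⟩
    ℓ ^ d    ≤⟨ m≤n*m (ℓ ^ d) (suc d) ⟩
    N        ∎
    where open ≤-Reasoning

-- Choice of parameters and real constants

C10-FreeC8Forcing : (ℕ → ℕ → Set) → ℕ → Set₁
C10-FreeC8Forcing P N₀ =
  Σ ℕ λ N → N₀ ≤ N × (Σ (Graph N) λ G → Bipartite G × (C 10 -Free) G
    × ((H : Subgraph G) → P ∣E G ∣ ∣E Subgraph.edges H ∣ → Copy (C 8) H))

-- Replaces the integer density condition by the real one, which implies it.
forcing-antitone : ∀ {P Q : ℕ → ℕ → Set} {N₀} → (∀ e h → Q e h → P e h) →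
                   C10-FreeC8Forcing P N₀ → C10-FreeC8Forcing Q N₀
forcing-antitone Q⇒P (N , N₀≤N , G , bipartite , C10-free , forced) =
  N , N₀≤N , G , bipartite , C10-free , λ H q → forced H (Q⇒P _ _ q)

grid-forcing : ∀ k .{{_ : NonZero k}} N₀ → C10-FreeC8Forcing (λ e h → e ≤ k * h) N₀
grid-forcing k N₀ =
  -- Dimension `2k + 1` serves the count over directions; side `2K² + N₀ + 1` serves the planar
  -- count and also makes `N` at least `N₀`.
  construct (suc (2 * k)) (2 * K * K + N₀) ≤-refl (s≤s (m≤m+n (2 * K * K) N₀)) (m≤n+m N₀ (suc (2 * K * K)))
  where
  K = 2 * k * k
  construct : ∀ d ℓ₀ → 2 * k < d → 2 * K * K < suc ℓ₀ → N₀ ≤ suc ℓ₀ →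
              C10-FreeC8Forcing (λ e h → e ≤ k * h) N₀
  construct d ℓ₀ 2k<d 2KK<ℓ N₀≤ℓ =
    N , ≤-trans N₀≤ℓ (ℓ≤N (≤-<-trans z≤n 2k<d)) , graph , bipartite , C10-free , dense⇒C8 k 2k<d 2KK<ℓ
    where open Incidence ℓ₀ d

-- `ℕ→ℚ` reduces its fraction to lowest terms, which is stuck on a variable; the unnormalised `e/1`
-- can be cross-multiplied directly.
toℚᵘ-ℕ→ℚ : ∀ e → ℚ.toℚᵘ (ℕ→ℚ e) ℚᵘ.≃ ℚᵘ.mkℚᵘ (ℤ.+ e) 0
toℚᵘ-ℕ→ℚ e = ℚ.toℚᵘ-fromℚᵘ (ℚᵘ.mkℚᵘ (ℤ.+ e) 0)

-- k is the denominator of a positive rational below c.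
positive⇒reciprocal-bound : (c : ℝ) → Positive c →
  ∃ λ k → NonZero k × (∀ e h → c · e ≤ᴿ h → e ≤ k * h)
positive⇒reciprocal-bound c 0<c with Equivalence.to (ℝ.L-rounded c ℚ.0ℚ) 0<c
... | mkℚ (ℤ.+ zero)  _ _ , *<* (ℤ.+<+ ()) , _
... | mkℚ ℤ.-[1+ _ ] _ _ , *<* () , _
-- Roundedness supplies `0 < r < c` with `r = (a + 1)/(b + 1)`. From `r e ≤ h` follows
-- `(a + 1) e ≤ (b + 1) h`, and the numerator may be dropped on the left.
... | r@(mkℚ ℤ.+[1+ a ] b _) , _ , r<c = suc b , _ , bound
  where
  open ≤-Reasoning
  bound : ∀ e h → c · e ≤ᴿ h → e ≤ suc b * h
  bound e h ce≤h = begin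
    e                      ≤⟨ m≤n*m e (suc a) ⟩
    -- The factors 1 are the denominators of `h` and `e` in the cross-multiplied inequality.
    suc a * e              ≡⟨ *-identityʳ _ ⟨
    suc a * e * 1          ≤⟨ ℤ.drop‿+≤+ (subst₂ ℤ._≤_ lhs rhs (ℚᵘ.drop-*≤* unnormalised)) ⟩
    h * (suc b * 1)        ≡⟨ trans (cong (h *_) (*-identityʳ (suc b))) (*-comm h (suc b)) ⟩
    suc b * h              ∎
    where
    unnormalised : ℚᵘ.mkℚᵘ ℤ.+[1+ a ] b ℚᵘ.* ℚᵘ.mkℚᵘ (ℤ.+ e) 0 ℚᵘ.≤ ℚᵘ.mkℚᵘ (ℤ.+ h) 0
    unnormalised = ℚᵘ.≤-respʳ-≃ (toℚᵘ-ℕ→ℚ h)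
      (ℚᵘ.≤-respˡ-≃ (ℚᵘ.≃-trans (ℚ.toℚᵘ-homo-* r (ℕ→ℚ e)) (ℚᵘ.*-congˡ {ℚ.toℚᵘ r} (toℚᵘ-ℕ→ℚ e)))
        (ℚ.toℚᵘ-mono-≤ (ce≤h r r<c)))
    lhs : ℤ.+[1+ a ] ℤ.* ℤ.+ e ℤ.* ℤ.+ 1 ≡ ℤ.+ (suc a * e * 1)
    lhs = trans (cong (ℤ._* ℤ.+ 1) (sym (ℤ.pos-* (suc a) e))) (sym (ℤ.pos-* (suc a * e) 1))
    rhs : ℤ.+ h ℤ.* ℤ.+ (suc b * 1) ≡ ℤ.+ (h * (suc b * 1))
    rhs = sym (ℤ.pos-* h (suc b * 1))

theorem1p2 : (c : ℝ) → Positive c → (N₀ : ℕ) → 1 ≤ N₀ →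
    Σ ℕ λ N → N₀ ≤ N × (Σ (Graph N) λ G →
    Bipartite G
    × (C 10 -Free) G
    × ((H : Subgraph G) → c · ∣E G ∣ ≤ᴿ ∣E Subgraph.edges H ∣ → Copy (C 8) H))
theorem1p2 c 0<c N₀ _ = from-reciprocal (positive⇒reciprocal-bound c 0<c)
  where
  from-reciprocal : (∃ λ k → NonZero k × (∀ e h → c · e ≤ᴿ h → e ≤ k * h)) → C10-FreeC8Forcing (c ·_≤ᴿ_) N₀
  from-reciprocal (k , k≢0 , bound) = forcing-antitone bound (grid-forcing k {{k≢0}} N₀)
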